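{- Let $H\colon\mathsf{Set}\to\mathsf{Set}$ be a zippable functor, let $\mathsf{select}$ be a $\mathsf{select}$ routine (on $\mathsf{Set}$) that respects compound blocks, and let $\xi\colon X\to HX$ be an $H$-coalgebra. Then the incremental computation of $P_{i+1}$ in the partition refinement algorithm is correct, that is, for every iteration $i$, $$P_{i+1}=\ker\big(H\langle\bar q_i,q_{i+1}\rangle\cdot\xi\big)=\ker\langle H\bar q_i\cdot\xi,\;Hq_{i+1}\cdot\xi\rangle=P_i\cap\ker(Hq_{i+1}\cdot\xi).$$
   Context: A functor $H\colon\mathsf{Set}\to\mathsf{Set}$ is zippable if for all sets $A,B$ the map $\langle H(A+!),H(!+B)\rangle\colon H(A+B)\to H(A+1)\times H(1+B)$ is injective, where $!$ denotes the unique map into the one-element set $1$. For a map $f\colon X\to Y$, $\ker f=\{(x,x')\in X\times X\mid f(x)=f(x')\}$. For an equivalence relation $R$ on $X$, $\kappa_R\colon X\twoheadrightarrow X/R$ is the canonical quotient map. A $\mathsf{select}$ routine is an operation that receives a chain of surjections $X\xrightarrow{y}Y\xrightarrow{z}Z$ and returns some map $\mathsf{select}(y,z)\colon Y\to K$. It respects compound blocks if whenever $k=\mathsf{select}(y,z)$, the union $\ker z\cup\ker k$ is a kernel, i.e. an equivalence relation on $Y$. Partition refinement algorithm: given $\xi\colon X\to HX$, put $Q_0=X\times X$, $\bar q_0=\,!\colon X\to 1=K_0$, $P_0=\ker(H!\cdot\xi)$. Then for $i=0,1,2,\dots$ (while $P_i\subsetneq Q_i$) put: (1) $q_{i+1}=\mathsf{select}(\kappa_{P_i},f_i)\cdot\kappa_{P_i}\colon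 X\to K_{i+1}$, where $f_i\colon X/P_i\twoheadrightarrow X/Q_i$ is the unique map with $f_i\cdot\kappa_{P_i}=\kappa_{Q_i}$ (it exists because always $P_i\subseteq Q_i$), and $\bar q_{i+1}=\langle\bar q_i,q_{i+1}\rangle\colon X\to\prod_{j\le i+1}K_j$; (2) $Q_{i+1}=\ker\bar q_{i+1}=Q_i\cap\ker q_{i+1}$; (3) $P_{i+1}=\ker(H\bar q_{i+1}\cdot\xi)$. The optimization replaces step (3) by $P'_{i+1}=\ker\langle H\bar q_i\cdot\xi,Hq_{i+1}\cdot\xi\rangle=P_i\cap\ker(Hq_{i+1}\cdot\xi)$; correctness of the optimization means $P'_{i+1}=P_{i+1}$. -}

-- Sets are modelled by setoids, the equality of a set being the setoid
-- equality.  This gives honest quotients X / R.  Carrier and equality live at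
-- one level ℓ, so that the sets of a universe are closed under 1, +, × and
-- quotients, and one endofunctor can be applied to all of them.

module Defs where

open import Data.Nat.Base using (ℕ; zero; suc)
open import Data.Product.Base using (_,_)
open import Data.Product.Function.NonDependent.Setoid using (<_,_>ₛ; proj₁ₛ)
open import Data.Product.Relation.Binary.Pointwise.NonDependent using (_×ₛ_)
open import Data.Sum.Function.Setoid using (_⊎-function_)
open import Data.Sum.Relation.Binary.Pointwise using (_⊎ₛ_)
open import Data.Unit.Polymorphic.Base using (tt)
open import Data.Unit.Polymorphic.Properties using (≡-setoid)
open import Function.Bundles using (Func; Surjection)
open import Function.Definitions using (Injective)
open import Level using (Level) renaming (suc to lsuc)
open import Relation.Binary.Bundles using (Setoid)
open import Relation.Binary.Construct.Union using (_∪_)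
open import Relation.Binary.Core using (Rel; _⇒_)
open import Relation.Binary.PropositionalEquality.Core using (refl)
open import Relation.Binary.Structures using (IsEquivalence)
import Function.Construct.Composition as Composition
import Function.Construct.Constant as Constant
import Function.Construct.Identity as Identity
import Function.Relation.Binary.Setoid.Equality as FuncEquality
import Relation.Binary.Construct.On as On

private
  variable
    ℓ : Level

infixr 9 _∙_
infix  4 _≗ₛ_
infixl 7 _/_

id : (A : Setoid ℓ ℓ) → Func A A
id A = Identity.function A

_∙_ : {A B C : Setoid ℓ ℓ} → Func B C → Func A B → Func A C
g ∙ f = Composition.function f g

_≗ₛ_ : {A B : Setoid ℓ ℓ} → Rel (Func A B) ℓ
_≗ₛ_ {A = A} {B = B} = FuncEquality._≈_ A B

𝟙 : Setoid ℓ ℓ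
𝟙 {ℓ} = ≡-setoid ℓ

! : {A : Setoid ℓ ℓ} → Func A 𝟙
! {A = A} = Constant.function A 𝟙 tt

record Endofunctor (ℓ : Level) : Set (lsuc ℓ) where
  field
    obj          : Setoid ℓ ℓ → Setoid ℓ ℓ
    hom          : {A B : Setoid ℓ ℓ} → Func A B → Func (obj A) (obj B)
    resp-≗       : {A B : Setoid ℓ ℓ} {f g : Func A B} → f ≗ₛ g → hom f ≗ₛ hom g
    identity     : {A : Setoid ℓ ℓ} → hom (id A) ≗ₛ id (obj A)
    homomorphism : {A B C : Setoid ℓ ℓ} (f : Func A B) (g : Func B C) →
                   hom (g ∙ f) ≗ₛ hom g ∙ hom f

Zippable : Endofunctor ℓ → Set (lsuc ℓ)
Zippable {ℓ} H = (A B : Setoid ℓ ℓ) →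
  Injective (Setoid._≈_ (obj (A ⊎ₛ B)))
            (Setoid._≈_ (obj (A ⊎ₛ 𝟙) ×ₛ obj (𝟙 ⊎ₛ B)))
            (Func.to < hom (id A ⊎-function !) , hom (! ⊎-function id B) >ₛ)
  where open Endofunctor H

Ker : {A B : Setoid ℓ ℓ} → Func A B → Rel (Setoid.Carrier A) ℓ
Ker {B = B} f x x′ = Setoid._≈_ B (Func.to f x) (Func.to f x′)

-- An equivalence relation on a set has to contain the equality of that set.
record EquivalenceOn (X : Setoid ℓ ℓ) : Set (lsuc ℓ) where
  field
    _∼_           : Rel (Setoid.Carrier X) ℓ
    isEquivalence : IsEquivalence _∼_
    respects-≈    : Setoid._≈_ X ⇒ _∼_

ker : {A B : Setoid ℓ ℓ} → Func A B → EquivalenceOn A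
ker {B = B} f = record
  { _∼_           = Ker f
  ; isEquivalence = On.isEquivalence (Func.to f) (Setoid.isEquivalence B)
  ; respects-≈    = Func.cong f
  }

_/_ : (X : Setoid ℓ ℓ) → EquivalenceOn X → Setoid ℓ ℓ
X / R = record { isEquivalence = EquivalenceOn.isEquivalence R }

κ : {X : Setoid ℓ ℓ} (R : EquivalenceOn X) → Surjection X (X / R)
κ R = record
  { to         = λ x → x
  ; cong       = EquivalenceOn.respects-≈ R
  ; surjective = λ x → x , EquivalenceOn.respects-≈ R
  }

-- The map f : X / P ↠ X / Q with f ∙ κ P = κ Q; it is the identity on
-- representatives.
coarsen : {X : Setoid ℓ ℓ} (P Q : EquivalenceOn X) →
          EquivalenceOn._∼_ P ⇒ EquivalenceOn._∼_ Q →
          Surjection (X / P) (X / Q)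
coarsen P Q P⊆Q = record
  { to         = λ x → x
  ; cong       = P⊆Q
  ; surjective = λ x → x , P⊆Q
  }

record SelectRoutine (ℓ : Level) : Set (lsuc ℓ) where
  field
    K      : {X Y Z : Setoid ℓ ℓ} → Surjection X Y → Surjection Y Z → Setoid ℓ ℓ
    select : {X Y Z : Setoid ℓ ℓ} (y : Surjection X Y) (z : Surjection Y Z) →
             Func Y (K y z)

RespectsCompoundBlocks : SelectRoutine ℓ → Set (lsuc ℓ)
RespectsCompoundBlocks {ℓ} S =
  {X Y Z : Setoid ℓ ℓ} (y : Surjection X Y) (z : Surjection Y Z) →
  IsEquivalence (Ker (Surjection.function z) ∪ Ker (select y z))
  where open SelectRoutine S

module PartitionRefinement
  {ℓ : Level} (H : Endofunctor ℓ) (S : SelectRoutine ℓ)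
  {X : Setoid ℓ ℓ} (ξ : Func X (Endofunctor.obj H X))
  where

  open Endofunctor H
  open SelectRoutine S

  -- The stage of iteration i consists of the product K̄ of K₀, …, Kᵢ and the
  -- map q̄ᵢ into it, which determine Qᵢ and Pᵢ.  The inclusion Pᵢ ⊆ Qᵢ is
  -- carried along because fᵢ needs it.
  record Stage : Set (lsuc ℓ) where
    field
      K̄   : Setoid ℓ ℓ
      q̄   : Func X K̄
      P⊆Q : Ker (hom q̄ ∙ ξ) ⇒ Ker q̄

    Q P : EquivalenceOn X
    Q = ker q̄
    P = ker (hom q̄ ∙ ξ)

    f : Surjection (X / P) (X / Q)
    f = coarsen P Q P⊆Q

    K⁺ : Setoid ℓ ℓ
    K⁺ = K (κ P) f

    q⁺ : Func X K⁺
    q⁺ = select (κ P) f ∙ Surjection.function (κ P)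

  initial : Stage
  initial = record { K̄ = 𝟙 ; q̄ = ! ; P⊆Q = λ _ → refl }

  next : Stage → Stage
  next s = record
    { K̄   = K̄ ×ₛ K⁺
    ; q̄   = q̄⁺
    ; P⊆Q = λ p → P⊆Q (P⁺⊆P p) , Func.cong (select (κ P) f) (P⁺⊆P p)
    }
    where
    open Stage s
    q̄⁺ : Func X (K̄ ×ₛ K⁺)
    q̄⁺ = < q̄ , q⁺ >ₛ

    P⁺⊆P : Ker (hom q̄⁺ ∙ ξ) ⇒ Ker (hom q̄ ∙ ξ)
    P⁺⊆P {x} {x′} p =
      trans (homomorphism q̄⁺ proj₁ₛ (Func.to ξ x))
        (trans (Func.cong (hom proj₁ₛ) p)
          (sym (homomorphism q̄⁺ proj₁ₛ (Func.to ξ x′))))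
      where open Setoid (obj K̄) using (sym; trans)

  -- The iteration is run without its exit test, hence is defined for all i,
  -- in particular for those with Pᵢ ⊊ Qᵢ.
  stage : ℕ → Stage
  stage zero    = initial
  stage (suc i) = next (stage i)

  q̄ : (i : ℕ) → Func X (Stage.K̄ (stage i))
  q̄ i = Stage.q̄ (stage i)

  -- q⁺ i is the map with index i + 1; there is no q₀.
  q⁺ : (i : ℕ) → Func X (Stage.K⁺ (stage i))
  q⁺ i = Stage.q⁺ (stage i)

  P Q : ℕ → Rel (Setoid.Carrier X) ℓ
  P i = EquivalenceOn._∼_ (Stage.P (stage i))
  Q i = EquivalenceOn._∼_ (Stage.Q (stage i))

{-# OPTIONS --safe #-}
-- If ker a ∪ ker b is transitive, then every block of this union is a single
-- block of ker a or a single block of ker b.  This splits the domain D into a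
-- part D₁ on which b determines a and a part D₂ on which a determines b, both
-- closed under ker a and ker b.  Hence ⟨a , b⟩ factorizes through a map
-- m : D → D₁/ker b + D₂/ker a, whose components m₁ : D → D₁/ker b + 1 and
-- m₂ : D → 1 + D₂/ker a factorize through b and a, respectively.  By
-- zippability, equality under Ha and Hb implies equality under Hm, and thus
-- under H⟨a , b⟩.  The theorem is the case a = q̄ᵢ, b = qᵢ₊₁.

module Submission where

open import Defs
open import Axiom.ExcludedMiddle using (ExcludedMiddle)
open import Data.Nat.Base using (ℕ; suc)
open import Data.Product.Base using (_×_; _,_; proj₁; proj₂; ∃-syntax)
open import Data.Product.Function.NonDependent.Setoid using (<_,_>ₛ; proj₁ₛ; proj₂ₛ)
open import Data.Product.Relation.Binary.Pointwise.NonDependent using (_×ₛ_)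
open import Data.Sum.Base using (inj₁; inj₂)
open import Data.Sum.Function.Setoid using (_⊎-function_; [_,_]ₛ; swapₛ)
open import Data.Sum.Relation.Binary.Pointwise using (_⊎ₛ_; inj₁; inj₂)
open import Data.Unit.Polymorphic.Base using (tt)
open import Function.Base using (_∘_)
open import Function.Bundles using (Func)
open import Level using (Level)
open import Relation.Binary.Bundles using (Setoid)
open import Relation.Binary.Construct.Intersection using (_∩_)
open import Relation.Binary.Construct.Union using (_∪_)
open import Relation.Binary.Core using (_⇔_; _⇒_)
open import Relation.Binary.Definitions using (Transitive)
open import Relation.Binary.PropositionalEquality.Core using (refl)
open import Relation.Binary.Structures using (IsEquivalence)
open import Relation.Nullary.Decidable.Core using (Dec; yes; no)
open import Relation.Nullary.Negation.Core using (¬_; contradiction)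
import Relation.Binary.Construct.On as On

private
  variable
    ℓ : Level

module _ (H : Endofunctor ℓ) where
  open Endofunctor H

  -- By functoriality, a factorization of `h` through `f` becomes one of `hom h` through `hom f`.
  Ker-hom-⇒ : {D A C : Setoid ℓ ℓ} {f : Func D A} {h : Func D C} (g : Func A C) →
              g ∙ f ≗ₛ h → Ker (hom f) ⇒ Ker (hom h)
  Ker-hom-⇒ {C = C} {f = f} {h} g gf≗h {t} {t′} p =
    trans (factorize t) (trans (Func.cong (hom g) p) (sym (factorize t′)))
    where
    open Setoid (obj C) using (_≈_; sym; trans)
    factorize : ∀ t → Func.to (hom h) t ≈ Func.to (hom g) (Func.to (hom f) t)
    factorize t = trans (sym (resp-≗ gf≗h t)) (homomorphism f g t)

  Ker-hom-∙ : {E F G : Setoid ℓ ℓ} (g : Func F G) (f : Func E F) →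
              Ker (hom (g ∙ f)) ⇒ Ker (hom g ∙ hom f)
  Ker-hom-∙ {G = G} g f {t} {t′} p =
    trans (sym (homomorphism f g t)) (trans p (homomorphism f g t′))
    where open Setoid (obj G) using (sym; trans)

-- T / f is the image of T under f, represented by the elements of T.
module PartialInverse (em : ExcludedMiddle ℓ) {D A : Setoid ℓ ℓ} (f : Func D A)
                      (T : Setoid.Carrier D → Set ℓ) where
  open Setoid A using (_≈_; sym; trans)
  open Func f using (to)

  T/f : Setoid ℓ ℓ
  T/f = On.setoid A (to ∘ proj₁ {B = T})

  private
    Preimage : Setoid.Carrier A → Set ℓ
    Preimage y = ∃[ x ] T x × to x ≈ y

    choose : ∀ {y} → Dec (Preimage y) → Setoid.Carrier (T/f ⊎ₛ 𝟙 {ℓ})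
    choose (yes (x , t , _)) = inj₁ (x , t)
    choose (no _)            = inj₂ tt

    -- The choice of preimage is immaterial, since `T/f` identifies elements with equal images; and
    -- equal points are both in the image or both outside it.
    choose-cong : ∀ {y y′} → y ≈ y′ → (d : Dec (Preimage y)) (d′ : Dec (Preimage y′)) →
                  Setoid._≈_ (T/f ⊎ₛ 𝟙 {ℓ}) (choose d) (choose d′)
    choose-cong y≈y′ (yes (_ , _ , p)) (yes (_ , _ , p′)) =
      inj₁ (trans p (trans y≈y′ (sym p′)))
    choose-cong y≈y′ (yes (x , t , p)) (no ¬d′) =
      contradiction (x , t , trans p y≈y′) ¬d′
    choose-cong y≈y′ (no ¬d) (yes (x , t , p)) =
      contradiction (x , t , trans p (sym y≈y′)) ¬d
    choose-cong y≈y′ (no _) (no _) = inj₂ refl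

  partialInverse : Func A (T/f ⊎ₛ 𝟙)
  partialInverse = record
    { to   = λ y → choose (em {Preimage y})
    ; cong = λ y≈y′ → choose-cong y≈y′ em em
    }

  partialInverse-∈ : ∀ {x} (t : T x) →
    Setoid._≈_ (T/f ⊎ₛ 𝟙 {ℓ}) (Func.to partialInverse (to x)) (inj₁ (x , t))
  partialInverse-∈ {x} t with em {Preimage (to x)}
  ... | yes (_ , _ , p) = inj₁ p
  ... | no ¬p           = contradiction (x , t , Setoid.refl A) ¬p

  partialInverse-∉ : ∀ {y} → (∀ {x} → T x → ¬ to x ≈ y) →
    Setoid._≈_ (T/f ⊎ₛ 𝟙 {ℓ}) (Func.to partialInverse y) (inj₂ tt)
  partialInverse-∉ {y} ∉image with em {Preimage y}
  ... | yes (_ , t , p) = contradiction p (∉image t)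
  ... | no _            = inj₂ refl

module CompoundBlocks (em : ExcludedMiddle ℓ) {D A B : Setoid ℓ ℓ}
                      (a : Func D A) (b : Func D B)
                      (∪-trans : Transitive (Ker a ∪ Ker b)) where
  private
    module A = Setoid A
    module B = Setoid B
    module D = Setoid D
    module a = Func a
    module b = Func b

  D₁ D₂ : D.Carrier → Set ℓ
  D₁ x = ∀ x′ → Ker b x x′ → Ker a x x′
  D₂ x = ¬ D₁ x

  D₁-resp-b : ∀ {x y} → Ker b x y → D₁ x → D₁ y
  D₁-resp-b p d z q = A.trans (A.sym (d _ p)) (d z (B.trans p q))

  -- If `y` and `z` agree under `b`, transitivity through `y` relates `x` to `z` by `a` or by `b`,
  -- and in `D₁` the latter implies the former.
  D₁-resp-a : ∀ {x y} → Ker a x y → D₁ x → D₁ y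
  D₁-resp-a {x} {y} p d z q with ∪-trans {x} {y} {z} (inj₁ p) (inj₂ q)
  ... | inj₁ r = A.trans (A.sym p) r
  ... | inj₂ r = A.trans (A.sym p) (d z r)

  D₂-determined : ∀ {x} → D₂ x → ∀ y → Ker a x y → Ker b x y
  D₂-determined {x} ¬d y p with em {Ker b x y}
  ... | yes q = q
  -- A `y` with the same `a`-value but another `b`-value forces `x` into `D₁`: any `z` in the
  -- `b`-block of `x` is related to `y` through `x`, and this cannot be by `b`.
  ... | no ¬q = contradiction d ¬d
    where
    d : D₁ x
    d z r with ∪-trans {z} {x} {y} (inj₂ (B.sym r)) (inj₁ p)
    ... | inj₁ s = A.trans p (A.sym s)
    ... | inj₂ s = contradiction (B.trans r s) ¬q

  open PartialInverse em b D₁ public using ()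
    renaming (T/f to D₁/b; partialInverse to b⁻¹
            ; partialInverse-∈ to b⁻¹-∈; partialInverse-∉ to b⁻¹-∉)
  open PartialInverse em a D₂ public using ()
    renaming (T/f to D₂/a; partialInverse to a⁻¹
            ; partialInverse-∈ to a⁻¹-∈; partialInverse-∉ to a⁻¹-∉)

  private
    classify : ∀ {x} → Dec (D₁ x) → Setoid.Carrier (D₁/b ⊎ₛ D₂/a)
    classify {x} (yes d) = inj₁ (x , d)
    classify {x} (no ¬d) = inj₂ (x , ¬d)

    classify-cong : ∀ {x x′} → x D.≈ x′ → (d : Dec (D₁ x)) (d′ : Dec (D₁ x′)) →
                    Setoid._≈_ (D₁/b ⊎ₛ D₂/a) (classify d) (classify d′)
    classify-cong p (yes _) (yes _)  = inj₁ (b.cong p)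
    classify-cong p (yes d) (no ¬d′) = contradiction (D₁-resp-b (b.cong p) d) ¬d′
    classify-cong p (no ¬d) (yes d′) = contradiction (D₁-resp-b (b.cong (D.sym p)) d′) ¬d
    classify-cong p (no _)  (no _)   = inj₂ (a.cong p)

  m : Func D (D₁/b ⊎ₛ D₂/a)
  m = record { to = λ x → classify (em {D₁ x}) ; cong = λ p → classify-cong p em em }

  m₁-factorizes : b⁻¹ ∙ b ≗ₛ (id D₁/b ⊎-function !) ∙ m
  m₁-factorizes x with em {D₁ x}
  ... | yes d = b⁻¹-∈ d
  -- Since `D₁` is closed under `Ker b`, no element of it shares its `b`-value with `x`.
  ... | no ¬d = b⁻¹-∉ λ d p → ¬d (D₁-resp-b p d)

  -- The swap is needed because partial inverses have their extra point on the right. Closure of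
  -- `D₁` under `Ker a` keeps the `a`-values of `D₁` out of the image of `D₂`.
  m₂-factorizes : (swapₛ ∙ a⁻¹) ∙ a ≗ₛ (! ⊎-function id D₂/a) ∙ m
  m₂-factorizes x with em {D₁ x}
  ... | yes d = Func.cong (swapₛ {S = D₂/a} {T = 𝟙}) (a⁻¹-∉ λ ¬d p → ¬d (D₁-resp-a (A.sym p) d))
  ... | no ¬d = Func.cong (swapₛ {S = D₂/a} {T = 𝟙}) (a⁻¹-∈ ¬d)

  -- Well defined because each summand is a quotient by the map that determines the other one there.
  pairing : Func (D₁/b ⊎ₛ D₂/a) (A ×ₛ B)
  pairing = [ record { to   = λ (x , _) → a.to x , b.to x
                     ; cong = λ { {_ , d} p → d _ p , p } }
            , record { to   = λ (x , _) → a.to x , b.to x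
                     ; cong = λ { {_ , ¬d} p → p , D₂-determined ¬d _ p } } ]ₛ

  pairing-factorizes : pairing ∙ m ≗ₛ < a , b >ₛ
  pairing-factorizes x with em {D₁ x}
  ... | yes _ = A.refl , B.refl
  ... | no _  = A.refl , B.refl

Ker-hom-<,>-⇔ : ExcludedMiddle ℓ → (H : Endofunctor ℓ) → Zippable H →
  let open Endofunctor H in
  {D A B : Setoid ℓ ℓ} (a : Func D A) (b : Func D B) → Transitive (Ker a ∪ Ker b) →
  Ker (hom < a , b >ₛ) ⇔ Ker < hom a , hom b >ₛ
Ker-hom-<,>-⇔ em H zip {D} {A} {B} a b ∪-trans =
    (λ p → Ker-hom-⇒ H proj₁ₛ (λ _ → Setoid.refl A) p
         , Ker-hom-⇒ H proj₂ₛ (λ _ → Setoid.refl B) p)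
  -- Equality under `hom b` yields the component in `D₁/b ⊎ₛ 𝟙`, equality under `hom a` the one in
  -- `𝟙 ⊎ₛ D₂/a`.
  , λ (p , q) → Ker-hom-⇒ H pairing pairing-factorizes
      (zip D₁/b D₂/a
        ( Ker-hom-∙ H (id D₁/b ⊎-function !) m (Ker-hom-⇒ H b⁻¹ m₁-factorizes q)
        , Ker-hom-∙ H (! ⊎-function id D₂/a) m (Ker-hom-⇒ H (swapₛ ∙ a⁻¹) m₂-factorizes p)))
  where
  open Endofunctor H
  open CompoundBlocks em {D} {A} {B} a b ∪-trans

theorem5p20 : {ℓ : Level} → ExcludedMiddle ℓ →
  (H : Endofunctor ℓ) → Zippable H →
  (S : SelectRoutine ℓ) → RespectsCompoundBlocks S →
  (X : Setoid ℓ ℓ) (ξ : Func X (Endofunctor.obj H X)) →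
  let open Endofunctor H
      open PartitionRefinement H S ξ
  in (i : ℕ) →
    (P (suc i) ⇔ Ker (hom < q̄ i , q⁺ i >ₛ ∙ ξ))
    × (Ker (hom < q̄ i , q⁺ i >ₛ ∙ ξ) ⇔ Ker < hom (q̄ i) ∙ ξ , hom (q⁺ i) ∙ ξ >ₛ)
    × (Ker < hom (q̄ i) ∙ ξ , hom (q⁺ i) ∙ ξ >ₛ ⇔ (P i ∩ Ker (hom (q⁺ i) ∙ ξ)))
theorem5p20 em H zip S compound X ξ i =
    -- The outer two equivalences hold by unfolding definitions; the middle one is `pair⇔` at points
    -- in the image of `ξ`.
    ((λ p → p) , (λ p → p))
  , (proj₁ pair⇔ , proj₂ pair⇔)
  , ((λ p → p) , (λ p → p))
  where
  open Endofunctor H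
  open PartitionRefinement H S ξ
  module s = Stage (stage i)

  pair⇔ : Ker (hom < q̄ i , q⁺ i >ₛ) ⇔ Ker < hom (q̄ i) , hom (q⁺ i) >ₛ
  pair⇔ = Ker-hom-<,>-⇔ em H zip (q̄ i) (q⁺ i)
    -- The quotient `X / s.P` has the carrier of `X`, and `s.f` is the identity on representatives;
    -- so the union of kernels there unfolds to `Ker (q̄ i) ∪ Ker (q⁺ i)`.
    (λ {x} {y} {z} → IsEquivalence.trans (compound (κ s.P) s.f) {x} {y} {z})
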